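{- For every set $\Gamma\cup\{\varphi\}\subseteq For(\Sigma)$, if $\Gamma\vDash_{DmbC}\varphi$, then $\Gamma\vdash_{DmbC}\varphi$.
   Context: **Syntax.** $For(\Sigma)$ is the set of formulas generated from a denumerable set of propositional variables by the signature $\Sigma=\{\to,\neg,\lor,\land,\mathsf{O},\circ\}$ ($\neg,\mathsf{O},\circ$ unary; $\to,\lor,\land$ binary). **The logic $DmbC$.** Hilbert calculus whose axiom schemas are those of $CPL^+$, the positive fragment of classical propositional logic in $\to,\land,\lor$ (for instance: $\alpha\to(\beta\to\alpha)$; $(\alpha\to(\beta\to\gamma))\to((\alpha\to\beta)\to(\alpha\to\gamma))$; $\alpha\to(\beta\to(\alpha\land\beta))$; $(\alpha\land\beta)\to\alpha$; $(\alpha\land\beta)\to\beta$; $\alpha\to(\alpha\lor\beta)$; $\beta\to(\alpha\lor\beta)$; $(\alpha\to\gamma)\to((\beta\to\gamma)\to((\alpha\lor\beta)\to\gamma))$; $\alpha\lor(\alpha\to\beta)$), plus - (EM) $\alpha\lor\neg\alpha$; - (bc) $\circ\alpha\to(\alpha\to(\neg\alpha\to\beta))$; - ($\mathsf{O}$-K) $\mathsf{O}(\alpha\to\beta)\to(\mathsf{O}\alpha\to\mathsf{O}\beta)$; - ($\mathsf{O}$-E) $\mathsf{O}\bot_\alpha\to\bot_\alpha$, where $\bot_\alpha:=(\alpha\land\neg\alpha)\land\circ\alpha$. The rules are Modus Ponens and $\mathsf{O}$-necessitation (from $\varphi$ infer $\mathsf{O}\varphi$). $\vdash_{DmbC}\varphi$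 means that there is a finite derivation of $\varphi$ from axioms (no premises) using these rules. $\Gamma\vdash_{DmbC}\varphi$ means: either $\vdash_{DmbC}\varphi$, or there are $\gamma_1,\dots,\gamma_k\in\Gamma$ ($k\ge 1$ finite) with $\vdash_{DmbC}(\gamma_1\land\dots\land\gamma_k)\to\varphi$. **Semantics.** Let $A=\{T,t,F\}$ with $T=(1,0)$, $t=(1,1)$, $F=(0,1)$; for $a\in A$ write $a=(a_1,a_2)$. Designated values: $\mathcal{D}=\{T,t\}$. Let $\sqcap,\sqcup,\supset,{\sim}$ be the Boolean meet, join, implication and complement on $\{0,1\}$, and $\bigwedge$ the meet of a non-empty subset of $\{0,1\}$. For $a,b\in A$ and $\emptyset\neq X\subseteq A$: - $a\,\tilde\land\,b=\{c\in A: c_1=a_1\sqcap b_1\}$; - $a\,\tilde\lor\,b=\{c\in A: c_1=a_1\sqcup b_1\}$; - $a\,\tilde\to\,b=\{c\in A: c_1=a_1\supset b_1\}$; - $\tilde\neg a=\{c\in A: c_1=a_2\}$; - $\tilde\circ a=\{c\in A: c_1\le{\sim}(a_1\sqcap a_2)\}$; - $\tilde{\mathsf{O}}(X)=\{c\in A: c_1=\bigwedge\{x_1:x\in X\}\}$. A swap Kripke model for $DmbC$ is a triple $\langle W,R,\{v_w\}_{w\in W}\rangle$ where $W\ne\emptyset$, $R\subseteq W^2$ is serial (every $w$ has some $w'$ with $wRw'$), and each $v_w:For(\Sigma)\to A$ satisfies, for all $\alpha,\beta$: $v_w(\alpha\#\beta)\in v_w(\alpha)\,\tilde\#\,v_w(\beta)$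 for $\#\in\{\land,\lor,\to\}$; $v_w(\neg\alpha)\in\tilde\neg v_w(\alpha)$; $v_w(\circ\alpha)\in\tilde\circ v_w(\alpha)$; $v_w(\mathsf{O}\alpha)\in\tilde{\mathsf{O}}(\{v_{w'}(\alpha): wRw'\})$. $\mathcal{M},w\vDash\alpha$ means $v_w(\alpha)\in\mathcal{D}$; $\mathcal{M},w\vDash\Gamma$ means $\mathcal{M},w\vDash\gamma$ for all $\gamma\in\Gamma$. $\Gamma\vDash_{DmbC}\alpha$ means: for every swap Kripke model $\mathcal{M}$ for $DmbC$ and every world $w$ of it, $\mathcal{M},w\vDash\Gamma$ implies $\mathcal{M},w\vDash\alpha$. -}

module Defs where

open import Data.Bool.Base as Bool using (Bool; true; false; not)
open import Data.List.NonEmpty.Base using (foldr₁)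
open import Data.List.NonEmpty.Relation.Unary.All using (All)
open import Data.Nat.Base using (ℕ)
open import Data.Product.Base using (_×_; ∃-syntax)
open import Data.Sum.Base using (_⊎_)
open import Level using (0ℓ)
open import Relation.Binary.Core using (Rel)
open import Relation.Binary.PropositionalEquality.Core using (_≡_)
open import Relation.Unary using (Pred; _∈_)

infix  9 ¬_ O_ ○_
infixr 7 _∧_
infixr 6 _∨_
infixr 5 _⇒_

data Formula : Set where
  var         : ℕ → Formula
  _⇒_ _∧_ _∨_ : Formula → Formula → Formula
  ¬_ O_ ○_    : Formula → Formula

bot : Formula → Formula
bot α = (α ∧ ¬ α) ∧ ○ α

data Axiom : Pred Formula 0ℓ where
  ⇒-weaken : ∀ α β   → Axiom (α ⇒ (β ⇒ α))
  ⇒-distr  : ∀ α β γ → Axiom ((α ⇒ (β ⇒ γ)) ⇒ ((α ⇒ β) ⇒ (α ⇒ γ)))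
  ∧-intro  : ∀ α β   → Axiom (α ⇒ (β ⇒ (α ∧ β)))
  ∧-elimˡ  : ∀ α β   → Axiom ((α ∧ β) ⇒ α)
  ∧-elimʳ  : ∀ α β   → Axiom ((α ∧ β) ⇒ β)
  ∨-introˡ : ∀ α β   → Axiom (α ⇒ (α ∨ β))
  ∨-introʳ : ∀ α β   → Axiom (β ⇒ (α ∨ β))
  ∨-elim   : ∀ α β γ → Axiom ((α ⇒ γ) ⇒ ((β ⇒ γ) ⇒ ((α ∨ β) ⇒ γ)))
  ∨-⇒      : ∀ α β   → Axiom (α ∨ (α ⇒ β))
  EM       : ∀ α     → Axiom (α ∨ ¬ α)
  bc       : ∀ α β   → Axiom (○ α ⇒ (α ⇒ (¬ α ⇒ β)))
  O-K      : ∀ α β   → Axiom (O (α ⇒ β) ⇒ (O α ⇒ O β))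
  O-E      : ∀ α     → Axiom (O (bot α) ⇒ bot α)

infix 3 ⊢₀_ _⊢_ _⊨_

data ⊢₀_ : Pred Formula 0ℓ where
  axiom : ∀ {φ}   → Axiom φ → ⊢₀ φ
  MP    : ∀ {φ ψ} → ⊢₀ φ ⇒ ψ → ⊢₀ φ → ⊢₀ ψ
  O-nec : ∀ {φ}   → ⊢₀ φ → ⊢₀ O φ

-- Premises enter only through a theorem (γ₁ ∧ … ∧ γₖ) ⇒ φ with k ≥ 1, so
-- O-necessitation is never applied to a premise.
_⊢_ : Pred Formula 0ℓ → Formula → Set
Γ ⊢ φ = (⊢₀ φ) ⊎ (∃[ γs ] All (_∈ Γ) γs × (⊢₀ foldr₁ _∧_ γs ⇒ φ))

-- The pairs (1,0), (1,1), (0,1); the projections are π₁ and π₂.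
data A : Set where
  T t F : A

π₁ π₂ : A → Bool
π₁ T = true
π₁ t = true
π₁ F = false
π₂ T = false
π₂ t = true
π₂ F = true

data Designated : Pred A 0ℓ where
  T-designated : Designated T
  t-designated : Designated t

_⊃_ : Bool → Bool → Bool
a ⊃ b = not a Bool.∨ b

-- b = ⋀ S in {0,1}.  The meet is a relation because S need not be decidable.
record IsMeet (S : Pred Bool 0ℓ) (b : Bool) : Set where
  field
    lower    : ∀ x → x ∈ S → b Bool.≤ x
    greatest : ∀ y → (∀ x → x ∈ S → y Bool.≤ x) → y Bool.≤ b

_∧̃_ _∨̃_ _⇒̃_ : A → A → Pred A 0ℓ
(a ∧̃ b) c = π₁ c ≡ π₁ a Bool.∧ π₁ b
(a ∨̃ b) c = π₁ c ≡ π₁ a Bool.∨ π₁ b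
(a ⇒̃ b) c = π₁ c ≡ π₁ a ⊃ π₁ b

¬̃_ ○̃_ : A → Pred A 0ℓ
(¬̃ a) c = π₁ c ≡ π₂ a
(○̃ a) c = π₁ c Bool.≤ not (π₁ a Bool.∧ π₂ a)

-- Only used for inhabited X: in a model, X is inhabited by seriality.
Õ : Pred A 0ℓ → Pred A 0ℓ
Õ X c = IsMeet (λ b → ∃[ x ] (x ∈ X × b ≡ π₁ x)) (π₁ c)

record SwapKripkeModel : Set₁ where
  field
    W        : Set
    nonempty : W
    R        : Rel W 0ℓ
    serial   : ∀ w → ∃[ w′ ] R w w′
    v        : W → Formula → A
    v-∧      : ∀ w α β → v w (α ∧ β) ∈ v w α ∧̃ v w β
    v-∨      : ∀ w α β → v w (α ∨ β) ∈ v w α ∨̃ v w β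
    v-⇒      : ∀ w α β → v w (α ⇒ β) ∈ v w α ⇒̃ v w β
    v-¬      : ∀ w α   → v w (¬ α) ∈ ¬̃ v w α
    v-○      : ∀ w α   → v w (○ α) ∈ ○̃ v w α
    v-O      : ∀ w α   → v w (O α) ∈ Õ (λ a → ∃[ w′ ] (R w w′ × a ≡ v w′ α))

  Sat : W → Formula → Set
  Sat w α = v w α ∈ Designated

  SatAll : W → Pred Formula 0ℓ → Set
  SatAll w Γ = ∀ γ → γ ∈ Γ → Sat w γ

_⊨_ : Pred Formula 0ℓ → Formula → Set₁
Γ ⊨ φ = (M : SwapKripkeModel) → let open SwapKripkeModel M in
        ∀ w → SatAll w Γ → Sat w φ

{-# OPTIONS --safe #-}

-- Contrapositive by a canonical model. If φ is not derivable from Γ, a Lindenbaum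
-- argument extends Γ to a prime theory omitting φ. The worlds are the nontrivial
-- prime theories w, with R w u iff {α : O α ∈ w} ⊆ u, and v w α is the element of A
-- whose first coordinate says whether α ∈ w and whose second says whether ¬ α ∈ w;
-- (EM) excludes the pair (0,0). Seriality comes from (O-E): since bot α implies
-- everything, {α : O α ∈ w} cannot prove it.
module Submission where

open import Defs
open import Axiom.ExcludedMiddle using (ExcludedMiddle)
open import Level using (0ℓ)
open import Relation.Unary using (Pred)

open import Data.Bool.Base as Bool using (Bool; true; false; not)
open import Data.Bool.Properties using (¬-not; not-¬)
open import Data.List.Base using (List; []; _∷_; concatMap)
open import Data.List.Membership.Propositional using (lose) renaming (_∈_ to _∈ₗ_)
open import Data.List.Membership.Propositional.Properties using (∈-concatMap⁺)
open import Data.List.NonEmpty.Base using (List⁺; _∷_; foldr₁; _⁺++⁺_)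
import Data.List.NonEmpty.Relation.Unary.All as All⁺
import Data.List.Relation.Unary.All as All
import Data.List.Relation.Unary.All.Properties as All
open import Data.List.Relation.Unary.Any using (here; there)
open import Data.Nat.Base using (ℕ; zero; suc; _⊔_; _≤′_; ≤′-refl; ≤′-step)
open import Data.Nat.Properties using (≤⇒≤′; m≤m⊔n; m≤n⊔m)
open import Data.Product.Base using (_×_; _,_; ∃-syntax)
open import Data.Sum.Base using (_⊎_; inj₁; inj₂; [_,_]′; map₁)
open import Relation.Binary.PropositionalEquality using (_≡_; refl; sym; trans; subst)
open import Relation.Nullary.Decidable using (Dec; yes; no; does; dec-true)
open import Relation.Nullary.Negation using (contradiction) renaming (¬_ to Not_)
open import Relation.Unary using (_∈_; _⊆_; _∪_; ｛_｝)

infix 3 _⊩_ _⊮_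

-- Necessitation enters only through `thm`, so it never touches a premise. Having `mp` as a
-- constructor spares the Lindenbaum argument any finite conjunctions; these return only in `⊩⇒⊢`.
data _⊩_ (X : Pred Formula 0ℓ) : Pred Formula 0ℓ where
  hyp : ∀ {φ}   → φ ∈ X → X ⊩ φ
  thm : ∀ {φ}   → ⊢₀ φ → X ⊩ φ
  mp  : ∀ {φ ψ} → X ⊩ φ ⇒ ψ → X ⊩ φ → X ⊩ ψ

_⊮_ : Pred Formula 0ℓ → Pred Formula 0ℓ
X ⊮ φ = Not (X ⊩ φ)

ax : ∀ {X φ} → Axiom φ → X ⊩ φ
ax a = thm (axiom a)

private variable
  X Y : Pred Formula 0ℓ
  α β φ ψ χ : Formula

-- Derivability from premises

⇒-refl : ∀ φ → ⊢₀ φ ⇒ φ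
⇒-refl φ = MP (MP (axiom (⇒-distr φ (φ ⇒ φ) φ)) (axiom (⇒-weaken φ (φ ⇒ φ))))
              (axiom (⇒-weaken φ φ))

⇒-const : ⊢₀ φ → ⊢₀ ψ ⇒ φ
⇒-const {φ} {ψ} p = MP (axiom (⇒-weaken φ ψ)) p

⇒-ap : ⊢₀ φ ⇒ (α ⇒ β) → ⊢₀ φ ⇒ α → ⊢₀ φ ⇒ β
⇒-ap {φ} {α} {β} p q = MP (MP (axiom (⇒-distr φ α β)) p) q

⇒-trans : ⊢₀ φ ⇒ ψ → ⊢₀ ψ ⇒ χ → ⊢₀ φ ⇒ χ
⇒-trans p q = ⇒-ap (⇒-const q) p

⊩-mono : X ⊆ Y → X ⊩ φ → Y ⊩ φ
⊩-mono X⊆Y (hyp x)  = hyp (X⊆Y x)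
⊩-mono X⊆Y (thm p)  = thm p
⊩-mono X⊆Y (mp d e) = mp (⊩-mono X⊆Y d) (⊩-mono X⊆Y e)

deduction : X ∪ ｛ α ｝ ⊩ β → X ⊩ α ⇒ β
deduction {α = α} {β} (hyp (inj₁ x))    = mp (ax (⇒-weaken β α)) (hyp x)
deduction {α = α}     (hyp (inj₂ refl)) = thm (⇒-refl α)
deduction             (thm p)           = thm (⇒-const p)
deduction {α = α} {β} (mp {φ} d e)      =
  mp (mp (ax (⇒-distr α φ β)) (deduction d)) (deduction e)

⊩-bot : ∀ α → X ⊩ bot α → X ⊩ β
⊩-bot {β = β} α d = mp (mp (mp (ax (bc α β)) c) a) b
  where
  ab = mp (ax (∧-elimˡ (α ∧ ¬ α) (○ α))) d
  a  = mp (ax (∧-elimˡ α (¬ α))) ab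
  b  = mp (ax (∧-elimʳ α (¬ α))) ab
  c  = mp (ax (∧-elimʳ (α ∧ ¬ α) (○ α))) d

⋀ : List⁺ Formula → Formula
⋀ = foldr₁ _∧_

-- `foldr₁` nests to the right and has no unit, so the induction is on the first list with a
-- singleton base. Together with `⋀-++ʳ` this lets `⊢-mp` pool the premises of both derivations.
⋀-++ˡ : ∀ γ γs δs → ⊢₀ ⋀ ((γ ∷ γs) ⁺++⁺ δs) ⇒ ⋀ (γ ∷ γs)
⋀-++ˡ γ []        (δ ∷ δs) = axiom (∧-elimˡ γ (⋀ (δ ∷ δs)))
⋀-++ˡ γ (γ′ ∷ γs) (δ ∷ δs) = ⇒-ap
  (⇒-trans (axiom (∧-elimˡ γ _)) (axiom (∧-intro γ _)))
  (⇒-trans (axiom (∧-elimʳ γ _)) (⋀-++ˡ γ′ γs (δ ∷ δs)))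

⋀-++ʳ : ∀ γ γs δs → ⊢₀ ⋀ ((γ ∷ γs) ⁺++⁺ δs) ⇒ ⋀ δs
⋀-++ʳ γ []        (δ ∷ δs) = axiom (∧-elimʳ γ (⋀ (δ ∷ δs)))
⋀-++ʳ γ (γ′ ∷ γs) (δ ∷ δs) =
  ⇒-trans (axiom (∧-elimʳ γ _)) (⋀-++ʳ γ′ γs (δ ∷ δs))

All-⁺++⁺ : ∀ {γs δs} → All⁺.All X γs → All⁺.All X δs → All⁺.All X (γs ⁺++⁺ δs)
All-⁺++⁺ (p All⁺.∷ ps) (q All⁺.∷ qs) = p All⁺.∷ All.++⁺ ps (q All.∷ qs)

⊢-mp : X ⊢ φ ⇒ ψ → X ⊢ φ → X ⊢ ψ
⊢-mp (inj₁ p)             (inj₁ q)             = inj₁ (MP p q)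
⊢-mp (inj₁ p)             (inj₂ (δs , δ∈ , q)) = inj₂ (δs , δ∈ , ⇒-trans q p)
⊢-mp (inj₂ (γs , γ∈ , p)) (inj₁ q)             = inj₂ (γs , γ∈ , ⇒-ap p (⇒-const q))
⊢-mp (inj₂ (γ ∷ γs , γ∈ , p)) (inj₂ (δs , δ∈ , q)) =
  inj₂ ((γ ∷ γs) ⁺++⁺ δs , All-⁺++⁺ γ∈ δ∈ ,
        ⇒-ap (⇒-trans (⋀-++ˡ γ γs δs) p) (⇒-trans (⋀-++ʳ γ γs δs) q))

⊩⇒⊢ : X ⊩ φ → X ⊢ φ
⊩⇒⊢ {φ = φ} (hyp x)  = inj₂ (φ ∷ [] , x All⁺.∷ All.[] , ⇒-refl φ)
⊩⇒⊢         (thm p)  = inj₁ p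
⊩⇒⊢         (mp d e) = ⊢-mp (⊩⇒⊢ d) (⊩⇒⊢ e)

-- Enumeration of formulas

-- Increasing finite lists exhausting the language; this takes the place of a
-- bijection with ℕ.
formulas : ℕ → List Formula
compounds : ℕ → Formula → List Formula
formulas zero    = []
formulas (suc n) = var n ∷ concatMap (compounds n) (formulas n)
-- `α` itself is listed so that each list contains the previous one.
compounds n α = α ∷ ¬ α ∷ O α ∷ ○ α ∷
  concatMap (λ β → (α ⇒ β) ∷ (α ∧ β) ∷ (α ∨ β) ∷ []) (formulas n)

compounds⊆formulas : ∀ {n} → α ∈ₗ formulas n → φ ∈ₗ compounds n α → φ ∈ₗ formulas (suc n)
compounds⊆formulas {n = n} α∈ φ∈ = there (∈-concatMap⁺ (compounds n) (lose α∈ φ∈))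

formulas-binary : ∀ {n} → α ∈ₗ formulas n → β ∈ₗ formulas n →
  φ ∈ₗ (α ⇒ β) ∷ (α ∧ β) ∷ (α ∨ β) ∷ [] → φ ∈ₗ formulas (suc n)
formulas-binary α∈ β∈ φ∈ = compounds⊆formulas α∈
  (there (there (there (there (∈-concatMap⁺ _ (lose β∈ φ∈))))))

formulas-mono : ∀ {m n} → m ≤′ n → α ∈ₗ formulas m → α ∈ₗ formulas n
formulas-mono ≤′-refl       α∈ = α∈
formulas-mono (≤′-step m≤n) α∈ = compounds⊆formulas (formulas-mono m≤n α∈) (here refl)

formulas-exhaust : ∀ α → ∃[ n ] α ∈ₗ formulas n
formulas-exhaust₂ : ∀ α β → ∃[ n ] (α ∈ₗ formulas n × β ∈ₗ formulas n)
formulas-exhaust (var n) = suc n , here refl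
formulas-exhaust (α ⇒ β) with _ , α∈ , β∈ ← formulas-exhaust₂ α β =
  _ , formulas-binary α∈ β∈ (here refl)
formulas-exhaust (α ∧ β) with _ , α∈ , β∈ ← formulas-exhaust₂ α β =
  _ , formulas-binary α∈ β∈ (there (here refl))
formulas-exhaust (α ∨ β) with _ , α∈ , β∈ ← formulas-exhaust₂ α β =
  _ , formulas-binary α∈ β∈ (there (there (here refl)))
formulas-exhaust (¬ α) with _ , α∈ ← formulas-exhaust α =
  _ , compounds⊆formulas α∈ (there (here refl))
formulas-exhaust (O α) with _ , α∈ ← formulas-exhaust α =
  _ , compounds⊆formulas α∈ (there (there (here refl)))
formulas-exhaust (○ α) with _ , α∈ ← formulas-exhaust α =
  _ , compounds⊆formulas α∈ (there (there (there (here refl))))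
formulas-exhaust₂ α β with m , α∈ ← formulas-exhaust α | n , β∈ ← formulas-exhaust β =
  m ⊔ n , formulas-mono (≤⇒≤′ (m≤m⊔n m n)) α∈ , formulas-mono (≤⇒≤′ (m≤n⊔m m n)) β∈

-- Prime theories

-- Boolean-valued, so that a world can be evaluated directly in A.
record PrimeTheory : Set where
  field
    member     : Formula → Bool
    theorems   : ⊢₀ α → member α ≡ true
    mp-closed  : member (α ⇒ β) ≡ true → member α ≡ true → member β ≡ true
    prime      : member (α ∨ β) ≡ true → member α ≡ true ⊎ member β ≡ true
    omitted    : Formula
    nontrivial : member omitted ≡ false

  ⊩-member : ∀ {X} → (∀ {α} → α ∈ X → member α ≡ true) → X ⊩ φ → member φ ≡ true
  ⊩-member X⊆ (hyp x)  = X⊆ x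
  ⊩-member X⊆ (thm p)  = theorems p
  ⊩-member X⊆ (mp d e) = mp-closed (⊩-member X⊆ d) (⊩-member X⊆ e)

  closed : Axiom (α ⇒ β) → member α ≡ true → member β ≡ true
  closed a = mp-closed (theorems (axiom a))

  omit : member β ≡ false → (member α ≡ true → member β ≡ true) → member α ≡ false
  omit β∉ α⇒β = ¬-not λ α∈ → not-¬ β∉ (α⇒β α∈)

  member-∧ : ∀ α β → member (α ∧ β) ≡ member α Bool.∧ member β
  member-∧ α β with member α in p | member β in q
  ... | true  | true  = mp-closed (closed (∧-intro α β) p) q
  ... | true  | false = omit q (closed (∧-elimʳ α β))
  ... | false | _     = omit p (closed (∧-elimˡ α β))

  member-∨ : ∀ α β → member (α ∨ β) ≡ member α Bool.∨ member β
  member-∨ α β with member α in p | member β in q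
  ... | true  | _     = closed (∨-introˡ α β) p
  ... | false | true  = closed (∨-introʳ α β) q
  ... | false | false =
    omit p λ r → [ (λ s → s) , (λ s → contradiction s (not-¬ q)) ]′ (prime r)

  -- If `α` is absent, primeness applied to `α ∨ (α ⇒ β)` leaves only the implication; `¬ α` cannot
  -- be used here, as it need not exclude `α`.
  member-⇒ : ∀ α β → member (α ⇒ β) ≡ (member α ⊃ member β)
  member-⇒ α β with member α in p | member β in q
  ... | true  | true  = closed (⇒-weaken β α) q
  ... | true  | false = omit q λ r → mp-closed r p
  ... | false | _     =
    [ (λ s → contradiction s (not-¬ p)) , (λ s → s) ]′ (prime (theorems (axiom (∨-⇒ α β))))

  member-¬ : ∀ α → member α ≡ false → member (¬ α) ≡ true
  member-¬ α p =
    [ (λ s → contradiction s (not-¬ p)) , (λ s → s) ]′ (prime (theorems (axiom (EM α))))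

  -- By (bc), a theory containing `○ α`, `α` and `¬ α` would contain `omitted`. Nothing forces `○ α`
  -- into the theory, hence an inequality.
  member-○ : ∀ α → member (○ α) Bool.≤ not (member α Bool.∧ member (¬ α))
  member-○ α with member (○ α) in r | member α in p | member (¬ α) in q
  ... | false | true  | true  = Bool.b≤b
  ... | true  | true  | true  = contradiction
    (mp-closed (mp-closed (closed (bc α omitted) r) p) q) (not-¬ nontrivial)
  ... | false | true  | false = Bool.f≤t
  ... | true  | true  | false = Bool.b≤b
  ... | false | false | _     = Bool.f≤t
  ... | true  | false | _     = Bool.b≤b

  obligations : Pred Formula 0ℓ
  obligations α = member (O α) ≡ true

  -- Boxing a derivation step by step: necessitation boxes theorems and (O-K) boxes modus ponens.
  ⊩-obligations : obligations ⊩ α → member (O α) ≡ true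
  ⊩-obligations         (hyp x)          = x
  ⊩-obligations         (thm p)          = theorems (O-nec p)
  ⊩-obligations {α = β} (mp {φ = α} d e) =
    mp-closed (closed (O-K α β) (⊩-obligations d)) (⊩-obligations e)

  obligations-consistent : ∀ α → obligations ⊮ bot α
  obligations-consistent α d = contradiction
    -- (O-E) puts `bot α` itself into the theory, and explosion from that single premise then yields
    -- `omitted`.
    (⊩-member {X = ｛ bot α ｝} (λ { refl → closed (O-E α) (⊩-obligations d) }) (⊩-bot α (hyp refl)))
    (not-¬ nontrivial)

open PrimeTheory using (member)

-- Lindenbaum's lemma

module Lindenbaum (em : ExcludedMiddle 0ℓ) {X : Pred Formula 0ℓ} {χ : Formula} (X⊮χ : X ⊮ χ) where

  -- The consistency condition is stored in the membership proof, so the set is defined without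
  -- deciding it: it adds `α` if `χ` stays underivable and is `Y` otherwise.
  _⊕_ : Pred Formula 0ℓ → Formula → Pred Formula 0ℓ
  (Y ⊕ α) β = β ∈ Y ⊎ (α ≡ β × (Y ∪ ｛ α ｝ ⊮ χ))

  extend : Pred Formula 0ℓ → List Formula → Pred Formula 0ℓ
  extend Y []       = Y
  extend Y (α ∷ αs) = extend (Y ⊕ α) αs

  extend-⊇ : ∀ αs → Y ⊆ extend Y αs
  extend-⊇ []       y = y
  extend-⊇ (α ∷ αs) y = extend-⊇ αs (inj₁ y)

  ⊕-⊮ : ∀ α → Y ⊮ χ → Y ⊕ α ⊮ χ
  ⊕-⊮ {Y} α Y⊮χ d with em {Y ∪ ｛ α ｝ ⊩ χ}
  ... | yes e = Y⊮χ (⊩-mono (λ { (inj₁ y) → y ; (inj₂ (_ , ⊮)) → contradiction e ⊮ }) d)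
  ... | no ⊮  = ⊮ (⊩-mono (λ { (inj₁ y) → inj₁ y ; (inj₂ (eq , _)) → inj₂ eq }) d)

  extend-⊮ : ∀ αs → Y ⊮ χ → extend Y αs ⊮ χ
  extend-⊮ []       Y⊮χ = Y⊮χ
  extend-⊮ (α ∷ αs) Y⊮χ = extend-⊮ αs (⊕-⊮ α Y⊮χ)

  -- A formula refused at its turn already gave `χ` there, and by monotonicity still does after
  -- later additions.
  extend-decides : ∀ αs → α ∈ₗ αs → α ∈ extend Y αs ⊎ (extend Y αs ∪ ｛ α ｝ ⊩ χ)
  extend-decides         (_ ∷ αs) (there α∈)  = extend-decides αs α∈
  extend-decides {Y = Y} (α ∷ αs) (here refl) with em {Y ∪ ｛ α ｝ ⊩ χ}
  ... | yes d = inj₂ (⊩-mono (map₁ λ y → extend-⊇ αs (inj₁ y)) d)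
  ... | no ⊮  = inj₁ (extend-⊇ αs (inj₂ (refl , ⊮)))

  stage : ℕ → Pred Formula 0ℓ
  stage zero    = X
  stage (suc n) = extend (stage n) (formulas n)

  stage-⊮ : ∀ n → stage n ⊮ χ
  stage-⊮ zero    = X⊮χ
  stage-⊮ (suc n) = extend-⊮ (formulas n) (stage-⊮ n)

  stage-mono : ∀ {m n} → m ≤′ n → stage m ⊆ stage n
  stage-mono ≤′-refl               x = x
  stage-mono (≤′-step {n = n} m≤n) x = extend-⊇ (formulas n) (stage-mono m≤n x)

  limit : Pred Formula 0ℓ
  limit α = ∃[ n ] α ∈ stage n

  -- A derivation uses finitely many premises, so the larger of two stages serves both halves of a
  -- modus ponens.
  limit-compact : limit ⊩ φ → ∃[ n ] (stage n ⊩ φ)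
  limit-compact (hyp (n , x)) = n , hyp x
  limit-compact (thm p)       = zero , thm p
  limit-compact (mp d e)
    with m , d′ ← limit-compact d | n , e′ ← limit-compact e
    = m ⊔ n , mp (⊩-mono (stage-mono (≤⇒≤′ (m≤m⊔n m n))) d′)
                 (⊩-mono (stage-mono (≤⇒≤′ (m≤n⊔m m n))) e′)

  limit-⊮ : limit ⊮ χ
  limit-⊮ d with n , d′ ← limit-compact d = stage-⊮ n d′

  limit-maximal : ∀ α → limit ⊩ α ⊎ limit ⊩ α ⇒ χ
  limit-maximal α with n , α∈ ← formulas-exhaust α
    with extend-decides {Y = stage n} (formulas n) α∈
  ... | inj₁ x = inj₁ (hyp (suc n , x))
  ... | inj₂ d = inj₂ (deduction (⊩-mono (map₁ (suc n ,_)) d))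

  -- If neither disjunct is derivable, maximality makes each imply `χ`, and (`∨-elim`) would derive
  -- `χ`.
  limit-prime : limit ⊩ α ∨ β → limit ⊩ α ⊎ limit ⊩ β
  limit-prime {α} {β} d with limit-maximal α | limit-maximal β
  ... | inj₁ a | _      = inj₁ a
  ... | inj₂ _ | inj₁ b = inj₂ b
  ... | inj₂ p | inj₂ q =
    contradiction (mp (mp (mp (ax (∨-elim α β χ)) p) q) d) limit-⊮

  decide : ∀ α → Dec (limit ⊩ α)
  decide α = em

  derive : does (decide α) ≡ true → limit ⊩ α
  derive {α} eq with yes d ← decide α = d

  theory : PrimeTheory
  theory = record
    -- Membership is derivability from `limit`, so closure under modus ponens is immediate; excluded
    -- middle makes it Boolean.
    { member     = λ α → does (decide α)
    ; theorems   = λ {α} p → dec-true (decide α) (thm p)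
    ; mp-closed  = λ {α} {β} p q → dec-true (decide β) (mp (derive p) (derive q))
    ; prime      = λ {α} {β} p →
        [ (λ a → inj₁ (dec-true (decide α) a)) , (λ b → inj₂ (dec-true (decide β) b)) ]′
        (limit-prime (derive p))
    ; omitted    = χ
    ; nontrivial = ¬-not λ p → limit-⊮ (derive p)
    }

  X⊆theory : α ∈ X → member theory α ≡ true
  X⊆theory {α} x = dec-true (decide α) (hyp (zero , x))

lindenbaum : ExcludedMiddle 0ℓ → X ⊮ χ →
  ∃[ w ] ((∀ {α} → α ∈ X → member w α ≡ true) × member w χ ≡ false)
lindenbaum em X⊮χ = theory , X⊆theory , PrimeTheory.nontrivial theory
  where open Lindenbaum em X⊮χ

-- The canonical model

-- The pair (false, false) is junk: it is sent to F.
pair : Bool → Bool → A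
pair true  false = T
pair true  true  = t
pair false _     = F

π₁-pair : ∀ a b → π₁ (pair a b) ≡ a
π₁-pair true  true  = refl
π₁-pair true  false = refl
π₁-pair false _     = refl

π₂-pair : ∀ a b → (a ≡ false → b ≡ true) → π₂ (pair a b) ≡ b
π₂-pair true  true  _ = refl
π₂-pair true  false _ = refl
π₂-pair false b     h = sym (h refl)

designated⇒π₁ : ∀ {a} → a ∈ Designated → π₁ a ≡ true
designated⇒π₁ T-designated = refl
designated⇒π₁ t-designated = refl

π₁⇒designated : ∀ a → π₁ a ≡ true → a ∈ Designated
π₁⇒designated T _ = T-designated
π₁⇒designated t _ = t-designated

≤-fromTrue : ∀ {a b} → (a ≡ true → b ≡ true) → a Bool.≤ b
≤-fromTrue {false} {false} _ = Bool.b≤b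
≤-fromTrue {false} {true}  _ = Bool.f≤t
≤-fromTrue {true}  {b}     h = subst (true Bool.≤_) (sym (h refl)) Bool.b≤b

≤-toTrue : ∀ {a b} → a Bool.≤ b → a ≡ true → b ≡ true
≤-toTrue Bool.b≤b p = p

value : PrimeTheory → Formula → A
value w α = pair (member w α) (member w (¬ α))

-- This is the truth lemma. It takes no induction on `α`, since `value` is given outright on every
-- formula; the work lies in checking the model conditions.
π₁-value : ∀ w α → π₁ (value w α) ≡ member w α
π₁-value w α = π₁-pair (member w α) (member w (¬ α))

π₂-value : ∀ w α → π₂ (value w α) ≡ member w (¬ α)
π₂-value w α = π₂-pair (member w α) (member w (¬ α)) (PrimeTheory.member-¬ w α)

module Canonical (em : ExcludedMiddle 0ℓ) where
  open PrimeTheory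

  R : PrimeTheory → PrimeTheory → Set
  R w u = ∀ {α} → α ∈ obligations w → member u α ≡ true

  serial : ∀ w → ∃[ u ] R w u
  -- Any formula would do inside `bot`; `omitted w` is at hand.
  serial w with u , Rwu , _ ← lindenbaum em (obligations-consistent w (omitted w)) = u , Rwu

  -- If the obligations of `w` do not derive `α`, Lindenbaum extends them to a successor omitting
  -- `α`, against the hypothesis.
  member-O : ∀ w α → (∀ u → R w u → member u α ≡ true) → member w (O α) ≡ true
  member-O w α h with em {obligations w ⊩ α}
  ... | yes d = ⊩-obligations w d
  ... | no ⊮ with u , Rwu , α∉u ← lindenbaum em ⊮ = contradiction (h u Rwu) (not-¬ α∉u)

  value-O : ∀ w α → value w (O α) ∈ Õ (λ a → ∃[ u ] (R w u × a ≡ value u α))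
  value-O w α rewrite π₁-value w (O α) = record
    { lower    = λ { _ (_ , (u , Rwu , refl) , refl) → ≤-fromTrue λ p →
                     trans (π₁-value u α) (Rwu p) }
    -- A lower bound `y` that is true forces `α` into every successor, which is the hypothesis of
    -- `member-O`.
    ; greatest = λ y y≤ → ≤-fromTrue λ p → member-O w α λ u Rwu →
                   trans (sym (π₁-value u α)) (≤-toTrue (y≤ _ (_ , (u , Rwu , refl) , refl)) p)
    }

  value-∧ : ∀ w α β → value w (α ∧ β) ∈ value w α ∧̃ value w β
  value-∧ w α β rewrite π₁-value w (α ∧ β) | π₁-value w α | π₁-value w β = member-∧ w α β

  value-∨ : ∀ w α β → value w (α ∨ β) ∈ value w α ∨̃ value w β
  value-∨ w α β rewrite π₁-value w (α ∨ β) | π₁-value w α | π₁-value w β = member-∨ w α β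

  value-⇒ : ∀ w α β → value w (α ⇒ β) ∈ value w α ⇒̃ value w β
  value-⇒ w α β rewrite π₁-value w (α ⇒ β) | π₁-value w α | π₁-value w β = member-⇒ w α β

  value-¬ : ∀ w α → value w (¬ α) ∈ ¬̃ value w α
  value-¬ w α = trans (π₁-value w (¬ α)) (sym (π₂-value w α))

  value-○ : ∀ w α → value w (○ α) ∈ ○̃ value w α
  value-○ w α rewrite π₁-value w (○ α) | π₁-value w α | π₂-value w α = member-○ w α

  model : PrimeTheory → SwapKripkeModel
  model w = record
    { W        = PrimeTheory
    ; nonempty = w
    ; R        = R
    ; serial   = serial
    ; v        = value
    ; v-∧      = value-∧
    ; v-∨      = value-∨
    ; v-⇒      = value-⇒
    ; v-¬      = value-¬
    ; v-○      = value-○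
    ; v-O      = value-O
    }

theorem2p18 : ExcludedMiddle 0ℓ → (Γ : Pred Formula 0ℓ) (φ : Formula) → Γ ⊨ φ → Γ ⊢ φ
theorem2p18 em Γ φ Γ⊨φ with em {Γ ⊩ φ}
... | yes d = ⊩⇒⊢ d
... | no ⊮ with w , Γ⊆w , φ∉w ← lindenbaum em ⊮ = contradiction φ∈w (not-¬ φ∉w)
  where
  φ∈w : member w φ ≡ true
  φ∈w = trans (sym (π₁-value w φ)) (designated⇒π₁ (Γ⊨φ (Canonical.model em w) w
    λ γ γ∈Γ → π₁⇒designated (value w γ) (trans (π₁-value w γ) (Γ⊆w γ∈Γ))))
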